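{- Let $k\ge 1$, $0\le \ell\le k-1$ and $r\ge 0$ be integers. The number $\bar{\mathcal P}_{r,k,\ell}$ of $k$-paths of length $n=kr+2\ell$ such that (iii) each internal $u$-segment has length equal to a multiple of $k$, and (iv) the first $u$-segment has length $\equiv \ell \pmod k$, is $$\bar{\mathcal P}_{r,k,\ell}=\sum_{p=0}^{\lfloor r/2\rfloor}\frac{\ell+1}{kp+\ell+1}\binom{(k+1)p+\ell}{p}\binom{r+(k-1)p+\ell}{r-2p}.$$
   Context: For $k\ge1$, a $k$-path of length $n$ is a lattice path from $(0,0)$ to $(n,0)$ with steps $u=(1,1)$, $d=(1,-1)$, $h=(k,0)$ that never goes below the $x$-axis. A $u$-segment of a $k$-path is a maximal sequence of consecutive up-steps; its length is its number of up-steps. An internal $u$-segment is a $u$-segment lying between two steps each of which is $d$ or $h$ (so any $u$-segment preceded by some step is internal). The first $u$-segment is the (possibly empty) run of up-steps with which the path begins; it has length $0$ if the path is empty or begins with $h$. -}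

module Defs where

open import Data.Integer as ℤ using (ℤ; +_; 0ℤ; 1ℤ; -1ℤ)
open import Data.List using (List; []; _∷_; _++_; foldr; length; replicate; takeWhile)
open import Data.List.Membership.Propositional using (_∈_)
open import Data.List.Relation.Unary.Unique.Propositional using (Unique)
open import Data.Nat using (ℕ; suc; _+_; _*_; _∸_; _≤_; NonZero)
open import Data.Nat.Combinatorics using (_C_)
open import Data.Nat.DivMod using (_%_)
open import Data.Nat.Divisibility using (_∣_)
open import Data.Product using (_×_; _,_; ∃-syntax; proj₂; zip)
open import Data.Rational as ℚ using (ℚ; _/_)
open import Function.Bundles using (_⇔_)
open import Relation.Binary.PropositionalEquality using (_≡_; _≢_; refl)
open import Relation.Nullary using (Dec; yes; no)

data Step : Set where
  u d h : Step

u? : ∀ s → Dec (s ≡ u)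
u? u = yes refl
u? d = no λ ()
u? h = no λ ()

displacement : ℕ → Step → ℤ × ℤ
displacement k u = 1ℤ , 1ℤ
displacement k d = 1ℤ , -1ℤ
displacement k h = + k , 0ℤ

endpoint : ℕ → List Step → ℤ × ℤ
endpoint k = foldr (λ s → zip ℤ._+_ ℤ._+_ (displacement k s)) (0ℤ , 0ℤ)

-- The heights at the vertices suffice, since every step is a straight segment.
record IsKPath (k n : ℕ) (w : List Step) : Set where
  field
    ends-at         : endpoint k w ≡ (+ n , 0ℤ)
    weakly-positive : ∀ xs ys → w ≡ xs ++ ys → 0ℤ ℤ.≤ proj₂ (endpoint k xs)

-- Maximality is automatic: both neighbouring steps differ from u.
InternalUSegment : List Step → ℕ → Set
InternalUSegment w m =
  1 ≤ m ×
  ∃[ xs ] ∃[ s ] ∃[ t ] ∃[ ys ]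
    s ≢ u × t ≢ u × w ≡ xs ++ s ∷ replicate m u ++ t ∷ ys

firstUSegmentLength : List Step → ℕ
firstUSegmentLength w = length (takeWhile u? w)

record IsCountedPath (k ℓ r : ℕ) .{{_ : NonZero k}} (w : List Step) : Set where
  field
    isKPath          : IsKPath k (k * r + 2 * ℓ) w
    internalSegments : ∀ m → InternalUSegment w m → k ∣ m
    firstSegment     : firstUSegmentLength w % k ≡ ℓ % k

-- The elements satisfying P (counted once each, regardless of how many
-- proofs of P they have) are exactly those of a repetition-free list of
-- length N.
HasCardinality : {A : Set} → (A → Set) → ℕ → Set
HasCardinality P N =
  ∃[ xs ] Unique xs × (∀ w → w ∈ xs ⇔ P w) × length xs ≡ N

-- Truncated subtraction is harmless here: k ≥ 1, and 2p ≤ r in the range of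
-- summation.
summand : ℕ → ℕ → ℕ → ℕ → ℚ
summand k ℓ r p =
  (+ (ℓ + 1) / suc (k * p + ℓ))
    ℚ.* (+ (((k + 1) * p + ℓ) C p) / 1)
    ℚ.* (+ ((r + (k ∸ 1) * p + ℓ) C (r ∸ 2 * p)) / 1)

{-# OPTIONS --safe #-}

-- Since ℓ < k, conditions (iii) and (iv) say that a counted path arises, in a
-- unique way, from a word in U, d, h by substituting uᵏ for U and putting ℓ
-- up-steps in front. With p letters U such a word has k p + ℓ letters
-- d and r − 2p letters h. The letters h can be inserted anywhere, which gives
-- the last binomial coefficient; the words without h are counted by the
-- ballot-type number (ℓ + 1)/(k p + ℓ + 1) · C((k + 1) p + ℓ, p), obtained by
-- induction from its subtractive form C(n, p) − k C(n, p − 1).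
module Submission where

open import Defs
open import Data.Empty using (⊥-elim)
open import Data.Fin using (Fin; toℕ; fromℕ<; zero; suc)
open import Data.Fin.Properties using (toℕ-injective; toℕ-fromℕ<; toℕ<n)
open import Data.Integer as ℤ using (ℤ; +_; 0ℤ; 1ℤ; -1ℤ)
import Data.Integer.Properties as ℤ
open import Data.List using (List; []; _∷_; _++_; concat; head; length; map; replicate; tabulate)
open import Data.List.Membership.Propositional using (_∈_)
open import Data.List.Membership.Propositional.Properties
open import Data.List.Properties using (length-++; length-map; ++-assoc; ++-cancelˡ; ∷-injectiveʳ)
open import Data.List.Relation.Binary.Disjoint.Propositional using (Disjoint)
open import Data.List.Relation.Unary.All as All using (All; []; _∷_)
import Data.List.Relation.Unary.All.Properties as All
open import Data.List.Relation.Unary.AllPairs using ([]; _∷_)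
import Data.List.Relation.Unary.AllPairs.Properties as AllPairs
open import Data.List.Relation.Unary.Any using (here)
open import Data.List.Relation.Unary.Unique.Propositional using (Unique)
import Data.List.Relation.Unary.Unique.Propositional.Properties as Unique
open import Data.Maybe using (Maybe; just; nothing)
open import Data.Nat as ℕ hiding (_/_; _%_)
open import Data.Nat.Combinatorics using (_C_; nCn≡1; nC1≡n; nCk≡nC[n∸k]; k>n⇒nCk≡0; nCk+nC[k+1]≡[n+1]C[k+1])
open import Data.Nat.DivMod using (_%_; m≡m%n+[m/n]*n; m<n⇒m%n≡m; %-remove-+ʳ)
open import Data.Nat.Divisibility using (_∣_; divides; _∣0; ∣m∣n⇒∣m+n; ∣-refl)
open import Data.Nat.Properties hiding (+-0-commutativeMonoid)
open import Data.Nat.Tactic.RingSolver using (solve-∀)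
open import Data.Product using (_×_; _,_; proj₁; proj₂; ∃-syntax)
open import Data.Rational as ℚ using (ℚ; fromℚᵘ; _/_)
open import Data.Rational.Properties using (+-0-commutativeMonoid)
import Data.Rational.Properties as ℚ
open import Data.Rational.Unnormalised as ℚᵘ using (mkℚᵘ; *≡*)
import Data.Rational.Unnormalised.Properties as ℚᵘ
open import Data.Sum using (inj₁; inj₂)
open import Algebra.Properties.CommutativeMonoid.Sum +-0-commutativeMonoid using (sum; sum-cong-≗; sum⁺-syntax)
open import Function using (_∘_; mk⇔)
open import Relation.Binary.PropositionalEquality
open ≡-Reasoning

-- Binomial coefficients and ballot numbers

nC0≡1 : ∀ n → n C 0 ≡ 1
nC0≡1 n = trans (nCk≡nC[n∸k] {0} {n} z≤n) (nCn≡1 n)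

-- Induction on `n`: Pascal's rule splits the left side, the two induction hypotheses turn it into
-- `suc n` times another Pascal sum, and the leftover `C₁` supplies the last copy.
[1+j]*[1+n]C[1+j]≡[1+n]*nCj : ∀ n j → suc j * (suc n C suc j) ≡ suc n * (n C j)
[1+j]*[1+n]C[1+j]≡[1+n]*nCj n zero = begin
  1 * (suc n C 1)   ≡⟨ cong (1 *_) (nC1≡n (suc n)) ⟩
  1 * suc n         ≡⟨ *-comm 1 (suc n) ⟩
  suc n * 1         ≡⟨ cong (suc n *_) (nC0≡1 n) ⟨
  suc n * (n C 0)   ∎
[1+j]*[1+n]C[1+j]≡[1+n]*nCj zero (suc j) = begin
  suc (suc j) * (1 C suc (suc j)) ≡⟨ cong (suc (suc j) *_) (k>n⇒nCk≡0 {1} {suc (suc j)} (s≤s z<s)) ⟩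
  suc (suc j) * 0                 ≡⟨ *-zeroʳ (suc (suc j)) ⟩
  1 * 0                           ≡⟨ cong (1 *_) (k>n⇒nCk≡0 {0} {suc j} z<s) ⟨
  1 * (0 C suc j)                 ∎
[1+j]*[1+n]C[1+j]≡[1+n]*nCj (suc n) (suc j) = begin
  suc (suc j) * (suc (suc n) C suc (suc j))
    ≡⟨ cong (suc (suc j) *_) (nCk+nC[k+1]≡[n+1]C[k+1] (suc n) (suc j)) ⟨
  suc (suc j) * (C₁ + C₂)
    ≡⟨ regroup (suc j) C₁ C₂ ⟩
  suc j * C₁ + suc (suc j) * C₂ + C₁
    ≡⟨ cong₂ (λ x y → x + y + C₁) ([1+j]*[1+n]C[1+j]≡[1+n]*nCj n j) ([1+j]*[1+n]C[1+j]≡[1+n]*nCj n (suc j)) ⟩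
  suc n * (n C j) + suc n * (n C suc j) + C₁
    ≡⟨ cong (_+ C₁) (*-distribˡ-+ (suc n) (n C j) (n C suc j)) ⟨
  suc n * (n C j + n C suc j) + C₁
    ≡⟨ cong (λ x → suc n * x + C₁) (nCk+nC[k+1]≡[n+1]C[k+1] n j) ⟩
  suc n * C₁ + C₁
    ≡⟨ +-comm (suc n * C₁) C₁ ⟩
  suc (suc n) * C₁ ∎
  where
  C₁ = suc n C suc j
  C₂ = suc n C suc (suc j)
  regroup : ∀ j x y → suc j * (x + y) ≡ j * x + suc j * y + x
  regroup = solve-∀

-- (j + 1) C(n, j + 1) = (n − j) C(n, j), without the subtraction.
[1+j]*nC[1+j]+j*nCj≡n*nCj : ∀ n j → suc j * (n C suc j) + j * (n C j) ≡ n * (n C j)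
[1+j]*nC[1+j]+j*nCj≡n*nCj n j = +-cancelˡ-≡ (n C j) _ _ (begin
  C₀ + (suc j * C₁ + j * C₀)  ≡⟨ regroup j C₀ C₁ ⟩
  suc j * (C₀ + C₁)           ≡⟨ cong (suc j *_) (nCk+nC[k+1]≡[n+1]C[k+1] n j) ⟩
  suc j * (suc n C suc j)     ≡⟨ [1+j]*[1+n]C[1+j]≡[1+n]*nCj n j ⟩
  suc n * C₀                  ∎)
  where
  C₀ = n C j
  C₁ = n C suc j
  regroup : ∀ j x y → x + (suc j * y + j * x) ≡ suc j * (x + y)
  regroup = solve-∀

-- With C(n, -1) = 0, Pascal's rule and the subtractive form of `ballot` make sense at index 0 as
-- well.
_C[_-1] : ℕ → ℕ → ℕ
n C[ zero  -1] = 0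
n C[ suc j -1] = n C j

pascal : ∀ n j → n C[ j -1] + n C j ≡ suc n C j
pascal n zero    = trans (nC0≡1 n) (sym (nC0≡1 (suc n)))
pascal n (suc j) = nCk+nC[k+1]≡[n+1]C[k+1] n j

-- The number of words with p letters U and k p + a letters d along which
-- the height, which starts at a and changes by + k and − 1, stays nonnegative.
ballot : ℕ → ℕ → ℕ → ℕ
ballot k zero    a       = 1
ballot k (suc p) zero    = ballot k p k
ballot k (suc p) (suc a) = ballot k p (suc a + k) + ballot k (suc p) a

-- The negative term of the subtractive form is moved to the left. The formula obeys the recursion
-- of `ballot` by Pascal's rule; at height 0, where the recursion has no term for d, the formula
-- taken at height -1 has to vanish.
ballot-reflection : ∀ k p a → let n = k * p + a + p in
  ballot k p a + k * n C[ p -1] ≡ n C p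
ballot-reflection k zero a = begin
  1 + k * 0              ≡⟨ cong suc (*-zeroʳ k) ⟩
  1                      ≡⟨ nC0≡1 (k * 0 + a + 0) ⟨
  (k * 0 + a + 0) C 0    ∎
ballot-reflection k (suc p) zero = begin
  ballot k p k + k * (n C p)
    ≡⟨ cong (λ x → ballot k p k + k * (x C p)) n≡1+m ⟩
  ballot k p k + k * (suc m C p)
    ≡⟨ cong (λ x → ballot k p k + k * x) (pascal m p) ⟨
  ballot k p k + k * (m C[ p -1] + m C p)
    ≡⟨ regroup (ballot k p k) k (m C[ p -1]) (m C p) ⟩
  (ballot k p k + k * m C[ p -1]) + k * (m C p)
    ≡⟨ cong₂ _+_ (ballot-reflection k p k) (sym m-central) ⟩
  m C p + m C suc p
    ≡⟨ pascal m (suc p) ⟩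
  suc m C suc p
    ≡⟨ cong (_C suc p) n≡1+m ⟨
  n C suc p ∎
  where
  m = k * p + k + p
  n = k * suc p + 0 + suc p
  n≡1+m′ : ∀ k p → k * suc p + 0 + suc p ≡ suc (k * p + k + p)
  n≡1+m′ = solve-∀
  n≡1+m : n ≡ suc m
  n≡1+m = n≡1+m′ k p
  regroup : ∀ b k x y → b + k * (x + y) ≡ (b + k * x) + k * y
  regroup = solve-∀
  expand : ∀ k p x → (k * p + k + p) * x ≡ suc p * (k * x) + p * x
  expand = solve-∀
  -- The vanishing at height -1: since m - p = k (p + 1), a factor p + 1 cancels.
  m-central : m C suc p ≡ k * (m C p)
  m-central = *-cancelˡ-≡ _ _ (suc p) (+-cancelʳ-≡ (p * (m C p)) _ _
    (trans ([1+j]*nC[1+j]+j*nCj≡n*nCj m p) (expand k p (m C p))))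
ballot-reflection k (suc p) (suc a) = begin
  (b₁ + b₂) + k * (n C p)
    ≡⟨ cong (λ x → (b₁ + b₂) + k * (x C p)) n≡1+m ⟩
  (b₁ + b₂) + k * (suc m C p)
    ≡⟨ cong (λ x → (b₁ + b₂) + k * x) (pascal m p) ⟨
  (b₁ + b₂) + k * (m C[ p -1] + m C p)
    ≡⟨ regroup b₁ b₂ k (m C[ p -1]) (m C p) ⟩
  (b₁ + k * m C[ p -1]) + (b₂ + k * (m C p))
    ≡⟨ cong₂ _+_
         (subst (λ x → b₁ + k * x C[ p -1] ≡ x C p) (m′≡m k p a) (ballot-reflection k p (suc a + k)))
         (ballot-reflection k (suc p) a) ⟩
  m C p + m C suc p
    ≡⟨ pascal m (suc p) ⟩
  suc m C suc p
    ≡⟨ cong (_C suc p) n≡1+m ⟨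
  n C suc p ∎
  where
  b₁ = ballot k p (suc a + k)
  b₂ = ballot k (suc p) a
  m = k * suc p + a + suc p
  n = k * suc p + suc a + suc p
  n≡1+m : n ≡ suc m
  n≡1+m = cong (_+ suc p) (+-suc (k * suc p) a)
  m′≡m : ∀ k p a → k * p + (suc a + k) + p ≡ k * suc p + a + suc p
  m′≡m = solve-∀
  regroup : ∀ b₁ b₂ k x y → (b₁ + b₂) + k * (x + y) ≡ (b₁ + k * x) + (b₂ + k * y)
  regroup = solve-∀

-- When the subtractive form is multiplied by `suc (k * p + a)`, its negative term becomes `k * p`
-- copies of the same binomial coefficient, so `suc a` copies remain.
ballot-formula : ∀ k p a →
  suc (k * p + a) * ballot k p a ≡ suc a * ((k * p + a + p) C p)
ballot-formula k zero a = cong₂ (λ x y → suc (x + a) * y) (*-zeroʳ k) (sym (nC0≡1 (k * 0 + a + 0)))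
ballot-formula k (suc p) a = +-cancelʳ-≡ (k * suc p * (n C suc p)) _ _ (begin
  suc q * b + k * suc p * (n C suc p)
    ≡⟨ cong (λ x → suc q * b + x) (*-assoc k (suc p) (n C suc p)) ⟩
  suc q * b + k * (suc p * (n C suc p))
    ≡⟨ cong (λ x → suc q * b + k * x) raise ⟩
  suc q * b + k * (suc q * (n C p))
    ≡⟨ regroup (suc q) b k (n C p) ⟩
  suc q * (b + k * (n C p))
    ≡⟨ cong (suc q *_) (ballot-reflection k (suc p) a) ⟩
  suc q * (n C suc p)
    ≡⟨ split (k * suc p) a (n C suc p) ⟩
  suc a * (n C suc p) + k * suc p * (n C suc p) ∎)
  where
  b = ballot k (suc p) a
  q = k * suc p + a
  n = q + suc p
  expand : ∀ q p x → (q + suc p) * x ≡ suc q * x + p * x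
  expand = solve-∀
  -- Here n - p = q + 1.
  raise : suc p * (n C suc p) ≡ suc q * (n C p)
  raise = +-cancelʳ-≡ (p * (n C p)) _ _
    (trans ([1+j]*nC[1+j]+j*nCj≡n*nCj n p) (expand q p (n C p)))
  regroup : ∀ q b k x → q * b + k * (q * x) ≡ q * (b + k * x)
  regroup = solve-∀
  split : ∀ j a x → suc (j + a) * x ≡ suc a * x + j * x
  split = solve-∀

-- Words in U, d, h

-- A path from height a to the axis read as a word over {U, d, h}, where U
-- abbreviates uᵏ; p and s are the numbers of letters U and h.
data BlockPath (k : ℕ) : (p s a : ℕ) → List Step → Set where
  nil  : BlockPath k 0 0 0 []
  up   : ∀ {p s a w} → BlockPath k p s (a + k) w → BlockPath k (suc p) s a (replicate k u ++ w)
  down : ∀ {p s a w} → BlockPath k p s a w → BlockPath k p s (suc a) (d ∷ w)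
  flat : ∀ {p s a w} → BlockPath k p s a w → BlockPath k p (suc s) a (h ∷ w)

-- Enumeration of the words

nils : (p s a : ℕ) → List (List Step)
nils 0 0 0 = [] ∷ []
nils _ _ _ = []

-- Splitting by first letter makes the pieces disjoint and lets their lengths follow the recursion
-- of the numbers.
blockPaths ups downs flats : (k p s a : ℕ) → List (List Step)

blockPaths k p s a = nils p s a ++ ups k p s a ++ downs k p s a ++ flats k p s a

ups k zero    s a = []
ups k (suc p) s a = map (replicate k u ++_) (blockPaths k p s (a + k))

downs k p s zero    = []
downs k p s (suc a) = map (d ∷_) (blockPaths k p s a)

flats k p zero    a = []
flats k p (suc s) a = map (h ∷_) (blockPaths k p s a)

∈-blockPaths⁺ : ∀ {k p s a w} → BlockPath k p s a w → w ∈ blockPaths k p s a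
∈-blockPaths⁺ nil = here refl
∈-blockPaths⁺ {k} {suc p} {s} {a} (up v) = ∈-++⁺ʳ (nils (suc p) s a)
  (∈-++⁺ˡ (∈-map⁺ (replicate k u ++_) (∈-blockPaths⁺ v)))
∈-blockPaths⁺ {k} {p} {s} {suc a} (down v) = ∈-++⁺ʳ (nils p s (suc a))
  (∈-++⁺ʳ (ups k p s (suc a)) (∈-++⁺ˡ (∈-map⁺ (d ∷_) (∈-blockPaths⁺ v))))
∈-blockPaths⁺ {k} {p} {suc s} {a} (flat v) = ∈-++⁺ʳ (nils p (suc s) a)
  (∈-++⁺ʳ (ups k p (suc s) a) (∈-++⁺ʳ (downs k p (suc s) a) (∈-map⁺ (h ∷_) (∈-blockPaths⁺ v))))

∈-nils⁻ : ∀ {k} p s a {w} → w ∈ nils p s a → BlockPath k p s a w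
∈-nils⁻ zero zero zero (here refl) = nil

∈-blockPaths⁻ : ∀ k p s a {w} → w ∈ blockPaths k p s a → BlockPath k p s a w
∈-ups⁻        : ∀ k p s a {w} → w ∈ ups k p s a → BlockPath k p s a w
∈-downs⁻      : ∀ k p s a {w} → w ∈ downs k p s a → BlockPath k p s a w
∈-flats⁻      : ∀ k p s a {w} → w ∈ flats k p s a → BlockPath k p s a w

∈-blockPaths⁻ k p s a w∈ with ∈-++⁻ (nils p s a) w∈
... | inj₁ w∈nils = ∈-nils⁻ p s a w∈nils
... | inj₂ w∈ with ∈-++⁻ (ups k p s a) w∈
... | inj₁ w∈ups = ∈-ups⁻ k p s a w∈ups
... | inj₂ w∈ with ∈-++⁻ (downs k p s a) w∈
... | inj₁ w∈downs = ∈-downs⁻ k p s a w∈downs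
... | inj₂ w∈flats = ∈-flats⁻ k p s a w∈flats

∈-ups⁻ k (suc p) s a w∈ with ∈-map⁻ (replicate k u ++_) w∈
... | _ , w∈ , refl = up (∈-blockPaths⁻ k p s (a + k) w∈)

∈-downs⁻ k p s (suc a) w∈ with ∈-map⁻ (d ∷_) w∈
... | _ , w∈ , refl = down (∈-blockPaths⁻ k p s a w∈)

∈-flats⁻ k p (suc s) a w∈ with ∈-map⁻ (h ∷_) w∈
... | _ , w∈ , refl = flat (∈-blockPaths⁻ k p s a w∈)

-- Absence of repetitions

-- `head` gives `nothing` on the empty word, so one tag separates all four pieces.
StartsWith : Maybe Step → List Step → Set
StartsWith x w = head w ≡ x

startsWith-disjoint : ∀ {x xs ys} →
  All (StartsWith x) xs → All (λ w → head w ≢ x) ys → Disjoint xs ys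
startsWith-disjoint all-x all-≢x (w∈xs , w∈ys) = All.lookup all-≢x w∈ys (All.lookup all-x w∈xs)

startsWith-≢ : ∀ {x y xs} → x ≢ y → All (StartsWith x) xs → All (λ w → head w ≢ y) xs
startsWith-≢ x≢y = All.map (λ head≡x head≡y → x≢y (trans (sym head≡x) head≡y))

nils-start : ∀ p s a → All (StartsWith nothing) (nils p s a)
nils-start zero    zero    zero    = refl ∷ []
nils-start zero    zero    (suc a) = []
nils-start zero    (suc s) a       = []
nils-start (suc p) s       a       = []

-- A block of `suc k` up-steps is nonempty, so its first step is visible.
ups-start : ∀ k p s a → All (StartsWith (just u)) (ups (suc k) p s a)
ups-start k zero    s a = []
ups-start k (suc p) s a = All.map⁺ (All.universal (λ _ → refl) _)

downs-start : ∀ k p s a → All (StartsWith (just d)) (downs k p s a)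
downs-start k p s zero    = []
downs-start k p s (suc a) = All.map⁺ (All.universal (λ _ → refl) _)

flats-start : ∀ k p s a → All (StartsWith (just h)) (flats k p s a)
flats-start k p zero    a = []
flats-start k p (suc s) a = All.map⁺ (All.universal (λ _ → refl) _)

nils-unique : ∀ p s a → Unique (nils p s a)
nils-unique zero    zero    zero    = [] ∷ []
nils-unique zero    zero    (suc a) = []
nils-unique zero    (suc s) a       = []
nils-unique (suc p) s       a       = []

-- Prepending a fixed word is injective, so each piece inherits uniqueness; different first letters
-- keep the pieces apart.
blockPaths-unique : ∀ k p s a → Unique (blockPaths (suc k) p s a)
ups-unique        : ∀ k p s a → Unique (ups (suc k) p s a)
downs-unique      : ∀ k p s a → Unique (downs (suc k) p s a)
flats-unique      : ∀ k p s a → Unique (flats (suc k) p s a)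

blockPaths-unique k p s a =
  Unique.++⁺ (nils-unique p s a)
    (Unique.++⁺ (ups-unique k p s a)
      (Unique.++⁺ (downs-unique k p s a) (flats-unique k p s a)
        (startsWith-disjoint ds (startsWith-≢ (λ ()) fs)))
      (startsWith-disjoint us
        (All.++⁺ (startsWith-≢ (λ ()) ds) (startsWith-≢ (λ ()) fs))))
    (startsWith-disjoint (nils-start p s a)
      (All.++⁺ (startsWith-≢ (λ ()) us)
        (All.++⁺ (startsWith-≢ (λ ()) ds) (startsWith-≢ (λ ()) fs))))
  where
  us = ups-start k p s a
  ds = downs-start (suc k) p s a
  fs = flats-start (suc k) p s a

ups-unique k zero    s a = []
ups-unique k (suc p) s a =
  Unique.map⁺ (++-cancelˡ (replicate (suc k) u) _ _) (blockPaths-unique k p s (a + suc k))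

downs-unique k p s zero    = []
downs-unique k p s (suc a) = Unique.map⁺ ∷-injectiveʳ (blockPaths-unique k p s a)

flats-unique k p zero    a = []
flats-unique k p (suc s) a = Unique.map⁺ ∷-injectiveʳ (blockPaths-unique k p s a)

-- Lengths of the enumerations

-- A word amounts to its `n` letters U and d, counted by `ballot`, and a free choice of places for
-- the letters h among all `n + s`. The induction removes the first letter.
length-blockPaths : ∀ k p s a → let n = k * p + a + p in
  length (blockPaths k p s a) ≡ ballot k p a * ((n + s) C s)
-- At `s = 0` the coefficient is 0 by convention, so the truncation in `∸ 1` does no harm.
length-flats : ∀ k p s a → let n = k * p + a + p in
  length (flats k p s a) ≡ ballot k p a * ((n + s ∸ 1) C[ s -1])
length-ups : ∀ k p s a → let n = k * p + (a + k) + p in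
  length (ups k (suc p) s a) ≡ ballot k p (a + k) * ((n + s) C s)
length-downs : ∀ k p s a → let n = k * p + a + p in
  length (downs k p s (suc a)) ≡ ballot k p a * ((n + s) C s)

length-ups k p s a =
  trans (length-map (replicate k u ++_) (blockPaths k p s (a + k))) (length-blockPaths k p s (a + k))

length-downs k p s a =
  trans (length-map (d ∷_) (blockPaths k p s a)) (length-blockPaths k p s a)

length-flats k p zero    a = sym (*-zeroʳ (ballot k p a))
length-flats k p (suc s) a = begin
  length (map (h ∷_) (blockPaths k p s a))   ≡⟨ length-map (h ∷_) (blockPaths k p s a) ⟩
  length (blockPaths k p s a)                ≡⟨ length-blockPaths k p s a ⟩
  b * ((n + s) C s)                          ≡⟨ cong (λ x → b * ((x ∸ 1) C s)) (+-suc n s) ⟨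
  b * ((n + suc s ∸ 1) C s)                  ∎
  where
  b = ballot k p a
  n = k * p + a + p

-- Deleting the first letter of a word of length n + s > 0: the words that
-- start with h are the second summand of Pascal's rule.
add-flats : ∀ k p s a {c m} → let n = k * p + a + p in n ≡ suc m →
  c ≡ ballot k p a * ((m + s) C s) →
  c + length (flats k p s a) ≡ ballot k p a * ((n + s) C s)
add-flats k p s a {c} {m} n≡1+m c≡ = begin
  c + length (flats k p s a)
    ≡⟨ cong₂ _+_ c≡ (length-flats k p s a) ⟩
  b * ((m + s) C s) + b * ((n + s ∸ 1) C[ s -1])
    ≡⟨ cong (λ x → b * ((m + s) C s) + b * ((x + s ∸ 1) C[ s -1])) n≡1+m ⟩
  b * ((m + s) C s) + b * ((m + s) C[ s -1])
    ≡⟨ regroup b ((m + s) C s) ((m + s) C[ s -1]) ⟩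
  b * ((m + s) C[ s -1] + (m + s) C s)
    ≡⟨ cong (b *_) (pascal (m + s) s) ⟩
  b * ((suc m + s) C s)
    ≡⟨ cong (λ x → b * ((x + s) C s)) n≡1+m ⟨
  b * ((n + s) C s) ∎
  where
  b = ballot k p a
  n = k * p + a + p
  regroup : ∀ b x y → b * x + b * y ≡ b * (y + x)
  regroup = solve-∀

length-blockPaths k zero zero zero = sym (trans (*-identityˡ _) (nC0≡1 (k * 0 + 0 + 0 + 0)))
-- Here `n` is 0, so `add-flats` does not apply; the only word is a run of `suc s` letters h.
length-blockPaths k zero (suc s) zero = begin
  length (flats k 0 (suc s) 0)          ≡⟨ length-flats k 0 (suc s) 0 ⟩
  1 * ((n + suc s ∸ 1) C s)             ≡⟨ cong (λ x → 1 * ((x + suc s ∸ 1) C s)) n≡0 ⟩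
  1 * (s C s)                           ≡⟨ cong (1 *_) (nCn≡1 s) ⟩
  1 * 1                                 ≡⟨ cong (1 *_) (nCn≡1 (suc s)) ⟨
  1 * (suc s C suc s)                   ≡⟨ cong (λ x → 1 * ((x + suc s) C suc s)) n≡0 ⟨
  1 * ((n + suc s) C suc s)             ∎
  where
  n = k * 0 + 0 + 0
  n≡0′ : ∀ k → k * 0 + 0 + 0 ≡ 0
  n≡0′ = solve-∀
  n≡0 : n ≡ 0
  n≡0 = n≡0′ k
length-blockPaths k zero s (suc a) = begin
  length (blockPaths k 0 s (suc a))
    ≡⟨ cong (λ xs → length (xs ++ downs k 0 s (suc a) ++ flats k 0 s (suc a))) (nils≡[] s) ⟩
  length (downs k 0 s (suc a) ++ flats k 0 s (suc a))
    ≡⟨ length-++ (downs k 0 s (suc a)) ⟩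
  length (downs k 0 s (suc a)) + length (flats k 0 s (suc a))
    ≡⟨ add-flats k 0 s (suc a) (cong (_+ 0) (+-suc (k * 0) a)) (length-downs k 0 s a) ⟩
  1 * ((k * 0 + suc a + 0 + s) C s) ∎
  where
  nils≡[] : ∀ s → nils 0 s (suc a) ≡ []
  nils≡[] zero    = refl
  nils≡[] (suc s) = refl
length-blockPaths k (suc p) s zero = begin
  length (ups k (suc p) s 0 ++ flats k (suc p) s 0)
    ≡⟨ length-++ (ups k (suc p) s 0) ⟩
  length (ups k (suc p) s 0) + length (flats k (suc p) s 0)
    ≡⟨ add-flats k (suc p) s 0 (length-suc k p) (length-ups k p s 0) ⟩
  ballot k (suc p) 0 * ((k * suc p + 0 + suc p + s) C s) ∎
  where
  length-suc : ∀ k p → k * suc p + 0 + suc p ≡ suc (k * p + k + p)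
  length-suc = solve-∀
length-blockPaths k (suc p) s (suc a) = begin
  length (ups k (suc p) s (suc a) ++ downs k (suc p) s (suc a) ++ flats k (suc p) s (suc a))
    ≡⟨ length-++ (ups k (suc p) s (suc a)) ⟩
  #ups + length (downs k (suc p) s (suc a) ++ flats k (suc p) s (suc a))
    ≡⟨ cong (λ x → #ups + x) (length-++ (downs k (suc p) s (suc a))) ⟩
  #ups + (#downs + #flats)
    ≡⟨ +-assoc #ups #downs #flats ⟨
  #ups + #downs + #flats
    ≡⟨ add-flats k (suc p) s (suc a) (cong (_+ suc p) (+-suc (k * suc p) a)) (begin
         #ups + #downs
           ≡⟨ cong₂ _+_ (length-ups k p s (suc a)) (length-downs k (suc p) s a) ⟩
         b₁ * ((k * p + (suc a + k) + p + s) C s) + b₂ * ((m + s) C s)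
           -- Removing U and removing d both leave `m` letters other than h, so the two pieces share
           -- a binomial coefficient and the recursion of `ballot` factors out.
           ≡⟨ cong (λ x → b₁ * ((x + s) C s) + b₂ * ((m + s) C s)) (length-pred k p a) ⟩
         b₁ * ((m + s) C s) + b₂ * ((m + s) C s)
           ≡⟨ *-distribʳ-+ ((m + s) C s) b₁ b₂ ⟨
         (b₁ + b₂) * ((m + s) C s) ∎) ⟩
  ballot k (suc p) (suc a) * ((k * suc p + suc a + suc p + s) C s) ∎
  where
  #ups = length (ups k (suc p) s (suc a))
  #downs = length (downs k (suc p) s (suc a))
  #flats = length (flats k (suc p) s (suc a))
  b₁ = ballot k p (suc a + k)
  b₂ = ballot k (suc p) a
  m = k * suc p + a + suc p
  length-pred : ∀ k p a → k * p + (suc a + k) + p ≡ k * suc p + a + suc p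
  length-pred = solve-∀

-- Counted paths as words

height : ℕ → List Step → ℤ
height k w = proj₂ (endpoint k w)

-- The current height is a natural number, so nonnegativity is built in: no constructor falls from
-- height 0. The horizontal coordinate is treated separately.
data Walk : ℕ → List Step → Set where
  stop  : Walk 0 []
  rise  : ∀ {a w} → Walk (suc a) w → Walk a (u ∷ w)
  fall  : ∀ {a w} → Walk a w → Walk (suc a) (d ∷ w)
  level : ∀ {a w} → Walk a w → Walk a (h ∷ w)

height-u : ∀ a H → + a ℤ.+ (1ℤ ℤ.+ H) ≡ + suc a ℤ.+ H
height-u a H = begin
  + a ℤ.+ (1ℤ ℤ.+ H)  ≡⟨ ℤ.+-assoc (+ a) 1ℤ H ⟨
  + (a + 1) ℤ.+ H     ≡⟨ cong (λ n → + n ℤ.+ H) (+-comm a 1) ⟩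
  + suc a ℤ.+ H       ∎

height-d : ∀ a H → + suc a ℤ.+ (-1ℤ ℤ.+ H) ≡ + a ℤ.+ H
height-d a H = sym (ℤ.+-assoc (+ suc a) -1ℤ H)

height-h : ∀ a H → + a ℤ.+ (0ℤ ℤ.+ H) ≡ + a ℤ.+ H
height-h a H = cong (λ z → + a ℤ.+ z) (ℤ.+-identityˡ H)

walk : ∀ k a w →
  (∀ xs ys → w ≡ xs ++ ys → 0ℤ ℤ.≤ + a ℤ.+ height k xs) →
  + a ℤ.+ height k w ≡ 0ℤ → Walk a w
walk k zero    []      pos end = stop
walk k (suc a) []      pos ()
walk k a       (u ∷ w) pos end = rise (walk k (suc a) w
  (λ xs ys eq → subst (0ℤ ℤ.≤_) (height-u a (height k xs)) (pos (u ∷ xs) ys (cong (u ∷_) eq)))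
  (trans (sym (height-u a (height k w))) end))
walk k zero    (d ∷ w) pos end with () ← pos (d ∷ []) w refl
walk k (suc a) (d ∷ w) pos end = fall (walk k a w
  (λ xs ys eq → subst (0ℤ ℤ.≤_) (height-d a (height k xs)) (pos (d ∷ xs) ys (cong (d ∷_) eq)))
  (trans (sym (height-d a (height k w))) end))
walk k a       (h ∷ w) pos end = level (walk k a w
  (λ xs ys eq → subst (0ℤ ℤ.≤_) (height-h a (height k xs)) (pos (h ∷ xs) ys (cong (h ∷_) eq)))
  (trans (sym (height-h a (height k w))) end))

walk-nonneg : ∀ k {a w} → Walk a w →
  ∀ xs ys → w ≡ xs ++ ys → 0ℤ ℤ.≤ + a ℤ.+ height k xs
walk-nonneg k {a} _ [] ys eq = ℤ.+≤+ z≤n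
walk-nonneg k {a} (rise v) (_ ∷ xs) ys refl =
  subst (0ℤ ℤ.≤_) (sym (height-u a (height k xs))) (walk-nonneg k v xs ys refl)
walk-nonneg k {suc a} (fall v) (_ ∷ xs) ys refl =
  subst (0ℤ ℤ.≤_) (sym (height-d a (height k xs))) (walk-nonneg k v xs ys refl)
walk-nonneg k {a} (level v) (_ ∷ xs) ys refl =
  subst (0ℤ ℤ.≤_) (sym (height-h a (height k xs))) (walk-nonneg k v xs ys refl)

walk-end : ∀ k {a w} → Walk a w → + a ℤ.+ height k w ≡ 0ℤ
walk-end k stop              = refl
walk-end k {a} (rise {w = w} v)     = trans (height-u a (height k w)) (walk-end k v)
walk-end k {suc a} (fall {w = w} v) = trans (height-d a (height k w)) (walk-end k v)
walk-end k {a} (level {w = w} v)    = trans (height-h a (height k w)) (walk-end k v)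

walk-rises : ∀ m {a w} → Walk (a + m) w → Walk a (replicate m u ++ w)
walk-rises zero    {a} {w} v = subst (λ b → Walk b w) (+-identityʳ a) v
walk-rises (suc m) {a} {w} v = rise (walk-rises m (subst (λ b → Walk b w) (+-suc a m) v))

blockPath⇒walk : ∀ {k p s a w} → BlockPath k p s a w → Walk a w
blockPath⇒walk nil          = stop
blockPath⇒walk {k} (up v)   = walk-rises k (blockPath⇒walk v)
blockPath⇒walk (down v)     = fall (blockPath⇒walk v)
blockPath⇒walk (flat v)     = level (blockPath⇒walk v)

width : ℕ → List Step → ℤ
width k w = proj₁ (endpoint k w)

width-rises : ∀ k m w {n} → width k w ≡ + n → width k (replicate m u ++ w) ≡ + (m + n)
width-rises k zero    w eq = eq
width-rises k (suc m) w eq = cong (λ z → 1ℤ ℤ.+ z) (width-rises k m w eq)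

-- There are `k * p` up-steps, `k * p + a` down-steps, and `s` level steps of width `k`.
width-blockPath : ∀ {k p s a w} → BlockPath k p s a w →
  width k w ≡ + (k * s + 2 * (k * p) + a)
width-blockPath {k} nil = cong +_ (width-nil k)
  where
  width-nil : ∀ k → 0 ≡ k * 0 + 2 * (k * 0) + 0
  width-nil = solve-∀
width-blockPath {k} (up {p} {s} {a} {w} v) =
  trans (width-rises k k w (width-blockPath v)) (cong +_ (width-up k p s a))
  where
  width-up : ∀ k p s a → k + (k * s + 2 * (k * p) + (a + k)) ≡ k * s + 2 * (k * suc p) + a
  width-up = solve-∀
width-blockPath {k} (down {p} {s} {a} v) =
  trans (cong (λ z → 1ℤ ℤ.+ z) (width-blockPath v)) (cong +_ (sym (+-suc (k * s + 2 * (k * p)) a)))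
width-blockPath {k} (flat {p} {s} {a} v) =
  trans (cong (λ z → + k ℤ.+ z) (width-blockPath v)) (cong +_ (width-flat k p s a))
  where
  width-flat : ∀ k p s a → k + (k * s + 2 * (k * p) + a) ≡ k * suc s + 2 * (k * p) + a
  width-flat = solve-∀

-- Cutting counted paths into blocks

InternalSegmentsDivisible : ℕ → List Step → Set
InternalSegmentsDivisible k w = ∀ m → InternalUSegment w m → k ∣ m

-- An internal segment brings both bounding steps with it, so it stays internal when `zs` is put in
-- front.
internal-++ : ∀ {k} zs {w} →
  InternalSegmentsDivisible k (zs ++ w) → InternalSegmentsDivisible k w
internal-++ zs div m (1≤m , xs , s , t , ys , s≢u , t≢u , refl) =
  div m (1≤m , zs ++ xs , s , t , ys , s≢u , t≢u , sym (++-assoc zs xs _))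

replicate-++ : ∀ (x : Step) m n w →
  replicate m x ++ replicate n x ++ w ≡ replicate (m + n) x ++ w
replicate-++ x zero    n w = refl
replicate-++ x (suc m) n w = cong (x ∷_) (replicate-++ x m n w)

replicate-shift : ∀ (x : Step) m w → replicate m x ++ x ∷ w ≡ replicate (suc m) x ++ w
replicate-shift x zero    w = refl
replicate-shift x (suc m) w = cong (x ∷_) (replicate-shift x m w)

blockPath-ups : ∀ {k p s} q {a w} → BlockPath k p s (a + q * k) w →
  BlockPath k (q + p) s a (replicate (q * k) u ++ w)
blockPath-ups {k} {p} {s} zero {a} {w} v = subst (λ b → BlockPath k p s b w) (+-identityʳ a) v
blockPath-ups {k} {p} {s} (suc q) {a} {w} v =
  subst (BlockPath k (suc q + p) s a) (replicate-++ u k (q * k) w)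
    (up (blockPath-ups q (subst (λ b → BlockPath k p s b w) (sym (+-assoc a k (q * k))) v)))

-- The up-steps read since the last non-up step x are kept in front of the
-- remaining walk; they are split into blocks at the next non-up step.
walk⇒blockPath : ∀ {k} m {x a b w} → x ≢ u →
  InternalSegmentsDivisible k (x ∷ replicate m u ++ w) →
  Walk b w → b ≡ a + m →
  ∃[ p ] ∃[ s ] BlockPath k p s a (replicate m u ++ w)

-- The run between `x` and `y` is internal, so `m = q * k` and it can be cut into `q` blocks.
close-segment : ∀ {k} m {x y a w} → x ≢ u → y ≢ u →
  InternalSegmentsDivisible k (x ∷ replicate m u ++ y ∷ w) →
  ∃[ p ] ∃[ s ] BlockPath k p s (a + m) (y ∷ w) →
  ∃[ p ] ∃[ s ] BlockPath k p s a (replicate m u ++ y ∷ w)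
close-segment {k} m {x} {y} {a} {w} x≢u y≢u div (p , s , v) with k∣m m div
  where
  k∣m : ∀ m → InternalSegmentsDivisible k (x ∷ replicate m u ++ y ∷ w) → k ∣ m
  -- An empty run is not an `InternalUSegment`, so its divisibility is supplied by hand.
  k∣m zero    _   = k ∣0
  k∣m (suc m) div = div (suc m) (z<s , [] , x , y , w , x≢u , y≢u , refl)
... | divides q refl = q + p , s , blockPath-ups q v

walk-after⇒blockPath : ∀ {k x a w} → x ≢ u →
  InternalSegmentsDivisible k (x ∷ w) → Walk a w → ∃[ p ] ∃[ s ] BlockPath k p s a w
walk-after⇒blockPath {a = a} x≢u div v = walk⇒blockPath 0 x≢u div v (sym (+-identityʳ a))

walk⇒blockPath zero    {a = zero} x≢u div stop eq = 0 , 0 , nil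
-- No run is pending at the end of the walk: it would put the final height above 0.
walk⇒blockPath (suc m) {a = a}    x≢u div stop eq with () ← trans eq (+-suc a m)
walk⇒blockPath {k} m {x} {a} x≢u div (rise {w = w} v) eq =
  subst (λ w → ∃[ p ] ∃[ s ] BlockPath k p s a w) (sym shift)
    (walk⇒blockPath (suc m) x≢u (subst (λ w → InternalSegmentsDivisible k (x ∷ w)) shift div) v
      (trans (cong suc eq) (sym (+-suc a m))))
  where shift = replicate-shift u m w
walk⇒blockPath {k} m {x} x≢u div (fall {w = w} v) b≡a+m =
  -- The step just read becomes the left boundary of the next run.
  let p , s , v′ = walk-after⇒blockPath (λ ()) (internal-++ (x ∷ replicate m u) div) v
  in close-segment m x≢u (λ ()) div (p , s , subst (λ b → BlockPath k p s b (d ∷ w)) b≡a+m (down v′))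
walk⇒blockPath {k} m {x} x≢u div (level {w = w} v) b≡a+m =
  let p , s , v′ = walk-after⇒blockPath (λ ()) (internal-++ (x ∷ replicate m u) div) v
  in close-segment m x≢u (λ ()) div (p , suc s , subst (λ b → BlockPath k p (suc s) b (h ∷ w)) b≡a+m (flat v′))

PrefixedBlockPath : ℕ → ℕ → List Step → Set
PrefixedBlockPath k ℓ w =
  ∃[ p ] ∃[ s ] ∃[ w′ ] w ≡ replicate ℓ u ++ w′ × BlockPath k p s ℓ w′

-- As `ℓ < k`, the remainder of `m` is `ℓ` itself. The first `ℓ` up-steps form the prefix and the
-- other `q * k` are cut into blocks.
close-first : ∀ {k ℓ} .{{_ : NonZero k}} → ℓ < k → ∀ m {w} → m % k ≡ ℓ % k →
  ∃[ p ] ∃[ s ] BlockPath k p s m w → PrefixedBlockPath k ℓ (replicate m u ++ w)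
close-first {k} {ℓ} ℓ<k m {w} m%k≡ℓ%k (p , s , v) =
  q + p , s , replicate (q * k) u ++ w ,
  trans (cong (λ m → replicate m u ++ w) m≡) (sym (replicate-++ u ℓ (q * k) w)) ,
  blockPath-ups q (subst (λ m → BlockPath k p s m w) m≡ v)
  where
  q = m ℕ./ k
  m≡ : m ≡ ℓ + q * k
  m≡ = trans (m≡m%n+[m/n]*n m k) (cong (_+ q * k) (trans m%k≡ℓ%k (m<n⇒m%n≡m ℓ<k)))

-- The first run has no step on its left, so the congruence replaces divisibility. The up-steps
-- already read number `m`, which keeps `m + firstUSegmentLength w` constant until the run ends.
walk⇒prefixed : ∀ {k ℓ} .{{_ : NonZero k}} → ℓ < k → ∀ m {w} →
  InternalSegmentsDivisible k (replicate m u ++ w) →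
  (m + firstUSegmentLength w) % k ≡ ℓ % k →
  Walk m w → PrefixedBlockPath k ℓ (replicate m u ++ w)
walk⇒prefixed ℓ<k .0 div first≡ stop = close-first ℓ<k 0 first≡ (0 , 0 , nil)
walk⇒prefixed {k} {ℓ} ℓ<k m div first≡ (rise {w = w} v) =
  subst (PrefixedBlockPath k ℓ) (sym shift)
    (walk⇒prefixed ℓ<k (suc m) (subst (InternalSegmentsDivisible k) shift div)
      (trans (cong (_% k) (sym (+-suc m (firstUSegmentLength w)))) first≡) v)
  where shift = replicate-shift u m w
walk⇒prefixed {k} ℓ<k .(suc m) div first≡ (fall {m} v) =
  let p , s , v′ = walk-after⇒blockPath (λ ()) (internal-++ (replicate (suc m) u) div) v
  in close-first ℓ<k (suc m) (trans (cong (_% k) (sym (+-identityʳ (suc m)))) first≡) (p , s , down v′)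
walk⇒prefixed {k} ℓ<k m div first≡ (level v) =
  let p , s , v′ = walk-after⇒blockPath (λ ()) (internal-++ (replicate m u) div) v
  in close-first ℓ<k m (trans (cong (_% k) (sym (+-identityʳ m))) first≡) (p , suc s , flat v′)

-- From words back to counted paths

first-replicate : ∀ m w → firstUSegmentLength (replicate m u ++ w) ≡ m + firstUSegmentLength w
first-replicate zero    w = refl
first-replicate (suc m) w = cong suc (first-replicate m w)

first-non-u : ∀ {t} ys → t ≢ u → firstUSegmentLength (t ∷ ys) ≡ 0
first-non-u {u} ys t≢u = ⊥-elim (t≢u refl)
first-non-u {d} ys t≢u = refl
first-non-u {h} ys t≢u = refl

-- Up-steps enter only in whole blocks. This serves the first segment directly and the internal ones
-- after passing to a suffix.
k∣first : ∀ {k p s a w} → BlockPath k p s a w → k ∣ firstUSegmentLength w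
k∣first {k} nil            = k ∣0
k∣first {k} (up {w = w} v) =
  subst (k ∣_) (sym (first-replicate k w)) (∣m∣n⇒∣m+n ∣-refl (k∣first v))
k∣first {k} (down v)       = k ∣0
k∣first {k} (flat v)       = k ∣0

after-replicate : ∀ m {w} xs {x zs} → x ≢ u → replicate m u ++ w ≡ xs ++ x ∷ zs →
  ∃[ xs′ ] w ≡ xs′ ++ x ∷ zs
after-replicate zero    xs       x≢u eq   = xs , eq
after-replicate (suc m) []       x≢u refl = ⊥-elim (x≢u refl)
after-replicate (suc m) (_ ∷ xs) x≢u eq   = after-replicate m xs x≢u (∷-injectiveʳ eq)

-- A cut just after a step other than u never falls inside a block.
blockPath-suffix : ∀ {k p s a w} → BlockPath k p s a w → ∀ xs {x zs} → x ≢ u →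
  w ≡ xs ++ x ∷ zs → ∃[ p′ ] ∃[ s′ ] ∃[ a′ ] BlockPath k p′ s′ a′ zs
blockPath-suffix nil      []       x≢u ()
blockPath-suffix nil      (_ ∷ xs) x≢u ()
blockPath-suffix {k} (up v) xs     x≢u eq =
  let xs′ , eq′ = after-replicate k xs x≢u eq in blockPath-suffix v xs′ x≢u eq′
blockPath-suffix (down v) []       x≢u refl = _ , _ , _ , v
blockPath-suffix (down v) (_ ∷ xs) x≢u eq   = blockPath-suffix v xs x≢u (∷-injectiveʳ eq)
blockPath-suffix (flat v) []       x≢u refl = _ , _ , _ , v
blockPath-suffix (flat v) (_ ∷ xs) x≢u eq   = blockPath-suffix v xs x≢u (∷-injectiveʳ eq)

-- An internal segment is the first segment of the suffix after its left boundary `x`; that suffix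
-- is again a word in blocks, so `k∣first` applies.
prefixed-internal : ∀ {k p s ℓ w} → BlockPath k p s ℓ w →
  InternalSegmentsDivisible k (replicate ℓ u ++ w)
prefixed-internal {k} {ℓ = ℓ} v m (_ , xs , x , t , ys , x≢u , t≢u , eq) =
  let xs′ , eq′ = after-replicate ℓ xs x≢u eq
      _ , _ , _ , v′ = blockPath-suffix v xs′ x≢u eq′
  in subst (k ∣_) first≡m (k∣first v′)
  where
  first≡m : firstUSegmentLength (replicate m u ++ t ∷ ys) ≡ m
  first≡m = trans (first-replicate m (t ∷ ys))
    (trans (cong (λ n → m + n) (first-non-u ys t≢u)) (+-identityʳ m))

width-prefixed : ∀ {k p s ℓ w} → BlockPath k p s ℓ w →
  width k (replicate ℓ u ++ w) ≡ + (k * (s + 2 * p) + 2 * ℓ)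
width-prefixed {k} {p} {s} {ℓ} {w} v =
  trans (width-rises k ℓ w (width-blockPath v)) (cong +_ (regroup k p s ℓ))
  where
  regroup : ∀ k p s ℓ → ℓ + (k * s + 2 * (k * p) + ℓ) ≡ k * (s + 2 * p) + 2 * ℓ
  regroup = solve-∀

prefixed⇒counted : ∀ {k p s ℓ r w} .{{_ : NonZero k}} → s + 2 * p ≡ r →
  BlockPath k p s ℓ w → IsCountedPath k ℓ r (replicate ℓ u ++ w)
prefixed⇒counted {k} {ℓ = ℓ} {w = w} refl v = record
  { isKPath = record
      { ends-at = cong₂ _,_ (width-prefixed v) (trans (sym (ℤ.+-identityˡ _)) (walk-end k prefixed-walk))
      ; weakly-positive = λ xs ys eq →
          subst (0ℤ ℤ.≤_) (ℤ.+-identityˡ _) (walk-nonneg k prefixed-walk xs ys eq)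
      }
  ; internalSegments = prefixed-internal v
  ; firstSegment = trans (cong (_% k) (first-replicate ℓ w)) (%-remove-+ʳ ℓ (k∣first v))
  }
  where
  prefixed-walk : Walk 0 (replicate ℓ u ++ w)
  prefixed-walk = walk-rises ℓ (blockPath⇒walk v)

counted⇒prefixed : ∀ {k ℓ r w} .{{_ : NonZero k}} → ℓ < k → IsCountedPath k ℓ r w →
  ∃[ p ] ∃[ s ] ∃[ w′ ] s + 2 * p ≡ r × w ≡ replicate ℓ u ++ w′ × BlockPath k p s ℓ w′
counted⇒prefixed {k} {ℓ} {r} {w} ℓ<k counted =
  let p , s , w′ , eq , v = walk⇒prefixed ℓ<k 0 internalSegments firstSegment
        (walk k 0 w
          (λ xs ys eq → subst (0ℤ ℤ.≤_) (sym (ℤ.+-identityˡ _)) (weakly-positive xs ys eq))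
          (trans (ℤ.+-identityˡ _) (cong proj₂ ends-at)))
      widths≡ = trans (sym (width-prefixed v)) (trans (cong (width k) (sym eq)) (cong proj₁ ends-at))
  in p , s , w′ ,
     -- The two widths are `k * (s + 2 * p) + 2 * ℓ` and `k * r + 2 * ℓ`; cancelling gives
     -- `s + 2 * p ≡ r`.
     *-cancelˡ-≡ _ _ k (+-cancelʳ-≡ (2 * ℓ) _ _ (ℤ.+-injective widths≡)) ,
     eq , v
  where
  open IsCountedPath counted
  open IsKPath isKPath

-- The number of counted paths

-- Recovers `s` from the bare word, which separates the lists belonging to different `p`.
countH : List Step → ℕ
countH []      = 0
countH (u ∷ w) = countH w
countH (d ∷ w) = countH w
countH (h ∷ w) = suc (countH w)

countH-rises : ∀ m w → countH (replicate m u ++ w) ≡ countH w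
countH-rises zero    w = refl
countH-rises (suc m) w = countH-rises m w

countH-blockPath : ∀ {k p s a w} → BlockPath k p s a w → countH w ≡ s
countH-blockPath nil                = refl
countH-blockPath {k} (up {w = w} v) = trans (countH-rises k w) (countH-blockPath v)
countH-blockPath (down v)           = countH-blockPath v
countH-blockPath (flat v)           = cong suc (countH-blockPath v)

≤⌊/2⌋⇒2*≤ : ∀ {p r} → p ≤ ⌊ r /2⌋ → 2 * p ≤ r
≤⌊/2⌋⇒2*≤ {p} {r} p≤ = subst (2 * p ≤_) (⌊n/2⌋+⌈n/2⌉≡n r)
  (+-mono-≤ p≤ (subst (_≤ ⌈ r /2⌉) (sym (+-identityʳ p)) (≤-trans p≤ (⌊n/2⌋≤⌈n/2⌉ r))))

2*≤⇒≤⌊/2⌋ : ∀ {p r} → 2 * p ≤ r → p ≤ ⌊ r /2⌋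
2*≤⇒≤⌊/2⌋ {p} {r} 2*p≤r = subst (_≤ ⌊ r /2⌋)
  (trans (cong (λ n → ⌊ p + n /2⌋) (+-identityʳ p)) (sym (n≡⌊n+n/2⌋ p)))
  (⌊n/2⌋-mono 2*p≤r)

-- Passage to rational numbers

fromℚᵘ-homo-+ : ∀ p q → fromℚᵘ p ℚ.+ fromℚᵘ q ≡ fromℚᵘ (p ℚᵘ.+ q)
fromℚᵘ-homo-+ p q = ℚ.toℚᵘ-injective (ℚᵘ.≃-trans (ℚ.toℚᵘ-homo-+ (fromℚᵘ p) (fromℚᵘ q))
  (ℚᵘ.≃-trans (ℚᵘ.+-cong (ℚ.toℚᵘ-fromℚᵘ p) (ℚ.toℚᵘ-fromℚᵘ q))
    (ℚᵘ.≃-sym (ℚ.toℚᵘ-fromℚᵘ (p ℚᵘ.+ q)))))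

fromℚᵘ-homo-* : ∀ p q → fromℚᵘ p ℚ.* fromℚᵘ q ≡ fromℚᵘ (p ℚᵘ.* q)
fromℚᵘ-homo-* p q = ℚ.toℚᵘ-injective (ℚᵘ.≃-trans (ℚ.toℚᵘ-homo-* (fromℚᵘ p) (fromℚᵘ q))
  (ℚᵘ.≃-trans (ℚᵘ.*-cong (ℚ.toℚᵘ-fromℚᵘ p) (ℚ.toℚᵘ-fromℚᵘ q))
    (ℚᵘ.≃-sym (ℚ.toℚᵘ-fromℚᵘ (p ℚᵘ.* q)))))

/1-homo-+ : ∀ m n → + (m + n) / 1 ≡ + m / 1 ℚ.+ + n / 1
/1-homo-+ m n = sym (trans (fromℚᵘ-homo-+ (mkℚᵘ (+ m) 0) (mkℚᵘ (+ n) 0))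
  (cong (_/ 1) (cong₂ ℤ._+_ (ℤ.*-identityʳ (+ m)) (ℤ.*-identityʳ (+ n)))))

length-concat-tabulate : ∀ {A : Set} {n} (f : Fin n → List A) →
  + length (concat (tabulate f)) / 1 ≡ sum (λ i → + length (f i) / 1)
length-concat-tabulate {n = zero}  f = refl
length-concat-tabulate {n = suc n} f = begin
  + length (f zero ++ concat (tabulate (f ∘ suc))) / 1
    ≡⟨ cong (λ m → + m / 1) (length-++ (f zero)) ⟩
  + (length (f zero) + length (concat (tabulate (f ∘ suc)))) / 1
    ≡⟨ /1-homo-+ (length (f zero)) _ ⟩
  + length (f zero) / 1 ℚ.+ + length (concat (tabulate (f ∘ suc))) / 1
    ≡⟨ cong (λ q → + length (f zero) / 1 ℚ.+ q) (length-concat-tabulate (f ∘ suc)) ⟩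
  + length (f zero) / 1 ℚ.+ sum (λ i → + length (f (suc i)) / 1) ∎

-- For unnormalised fractions equality is cross-multiplication, so the claim becomes `eq` multiplied
-- by `c′`, with no gcd to handle.
quotient-product : ∀ x n c b c′ → suc n * b ≡ x * c →
  (+ x / suc n) ℚ.* (+ c / 1) ℚ.* (+ c′ / 1) ≡ + (b * c′) / 1
quotient-product x n c b c′ eq = begin
  (+ x / suc n) ℚ.* (+ c / 1) ℚ.* (+ c′ / 1)
    ≡⟨ cong (ℚ._* (+ c′ / 1)) (fromℚᵘ-homo-* (mkℚᵘ (+ x) n) (mkℚᵘ (+ c) 0)) ⟩
  fromℚᵘ (mkℚᵘ (+ x) n ℚᵘ.* mkℚᵘ (+ c) 0) ℚ.* (+ c′ / 1)
    ≡⟨ fromℚᵘ-homo-* (mkℚᵘ (+ x) n ℚᵘ.* mkℚᵘ (+ c) 0) (mkℚᵘ (+ c′) 0) ⟩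
  fromℚᵘ (mkℚᵘ (+ x) n ℚᵘ.* mkℚᵘ (+ c) 0 ℚᵘ.* mkℚᵘ (+ c′) 0)
    ≡⟨ ℚ.fromℚᵘ-cong {mkℚᵘ (+ x) n ℚᵘ.* mkℚᵘ (+ c) 0 ℚᵘ.* mkℚᵘ (+ c′) 0} {mkℚᵘ (+ (b * c′)) 0} (*≡* cross) ⟩
  + (b * c′) / 1 ∎
  where
  expand : ∀ n b c′ → suc n * b * c′ * 1 ≡ b * c′ * (suc n * 1 * 1)
  expand = solve-∀
  cross : + x ℤ.* + c ℤ.* + c′ ℤ.* + 1 ≡ + (b * c′) ℤ.* + (suc n * 1 * 1)
  cross = begin
    + x ℤ.* + c ℤ.* + c′ ℤ.* + 1
      ≡⟨ cong (λ z → z ℤ.* + c′ ℤ.* + 1) (ℤ.pos-* x c) ⟨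
    + (x * c) ℤ.* + c′ ℤ.* + 1
      ≡⟨ cong (ℤ._* + 1) (ℤ.pos-* (x * c) c′) ⟨
    + (x * c * c′) ℤ.* + 1
      ≡⟨ ℤ.pos-* (x * c * c′) 1 ⟨
    + (x * c * c′ * 1)
      ≡⟨ cong (λ y → + (y * c′ * 1)) eq ⟨
    + (suc n * b * c′ * 1)
      ≡⟨ cong +_ (expand n b c′) ⟩
    + (b * c′ * (suc n * 1 * 1))
      ≡⟨ ℤ.pos-* (b * c′) (suc n * 1 * 1) ⟩
    + (b * c′) ℤ.* + (suc n * 1 * 1) ∎

-- Taking `r` as `s + 2 * p` makes the lower index `r ∸ 2 * p` equal to `s`; the rest matches the
-- upper indices.
length-blockPaths≡summand : ∀ k ℓ p s →
  + length (blockPaths (suc k) p s ℓ) / 1 ≡ summand (suc k) ℓ (s + 2 * p) p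
length-blockPaths≡summand k ℓ p s = begin
  + length (blockPaths (suc k) p s ℓ) / 1
    ≡⟨ cong (λ n → + n / 1) (length-blockPaths (suc k) p s ℓ) ⟩
  + (ballot (suc k) p ℓ * ((suc k * p + ℓ + p + s) C s)) / 1
    ≡⟨ quotient-product (suc ℓ) (suc k * p + ℓ) ((suc k * p + ℓ + p) C p) (ballot (suc k) p ℓ) _
         (ballot-formula (suc k) p ℓ) ⟨
  product (suc ℓ) (suc k * p + ℓ + p) (suc k * p + ℓ + p + s) s
    ≡⟨ cong₂ (λ x n → product x n (suc k * p + ℓ + p + s) s) (+-comm 1 ℓ) (length₁ k ℓ p) ⟩
  product (ℓ + 1) ((suc k + 1) * p + ℓ) (suc k * p + ℓ + p + s) s
    ≡⟨ cong₂ (product (ℓ + 1) ((suc k + 1) * p + ℓ)) (length₂ k ℓ p s) (sym (m+n∸n≡m s (2 * p))) ⟩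
  summand (suc k) ℓ (s + 2 * p) p ∎
  where
  product : ℕ → ℕ → ℕ → ℕ → ℚ
  product x n m s = (+ x / suc (suc k * p + ℓ)) ℚ.* (+ (n C p) / 1) ℚ.* (+ (m C s) / 1)
  length₁ : ∀ k ℓ p → suc k * p + ℓ + p ≡ (suc k + 1) * p + ℓ
  length₁ = solve-∀
  length₂ : ∀ k ℓ p s → suc k * p + ℓ + p + s ≡ s + 2 * p + k * p + ℓ
  length₂ = solve-∀

-- Union over the number of blocks

module _ (k ℓ r : ℕ) (ℓ<k : ℓ < suc k) where

  blockPathsOf : Fin (suc ⌊ r /2⌋) → List (List Step)
  blockPathsOf i = blockPaths (suc k) (toℕ i) (r ∸ 2 * toℕ i) ℓ

  countedPaths : List (List Step)
  countedPaths = map (replicate ℓ u ++_) (concat (tabulate blockPathsOf))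

  2*i≤r : (i : Fin (suc ⌊ r /2⌋)) → 2 * toℕ i ≤ r
  2*i≤r i = ≤⌊/2⌋⇒2*≤ (≤-pred (toℕ<n i))

  countedPaths-unique : Unique countedPaths
  countedPaths-unique = Unique.map⁺ (++-cancelˡ (replicate ℓ u) _ _)
    (Unique.concat⁺
      (All.tabulate⁺ {f = blockPathsOf} (λ i → blockPaths-unique k (toℕ i) (r ∸ 2 * toℕ i) ℓ))
      -- A word in both lists has `r ∸ 2 * toℕ i` and also `r ∸ 2 * toℕ j` letters h; neither
      -- subtraction truncates, so the indices agree.
      (AllPairs.tabulate⁺ {f = blockPathsOf} λ {i} {j} i≢j (w∈i , w∈j) → i≢j (toℕ-injective (*-cancelˡ-≡ _ _ 2
        (∸-cancelˡ-≡ (2*i≤r i) (2*i≤r j)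
          (trans (sym (countH-blockPath (∈-blockPaths⁻ (suc k) (toℕ i) _ ℓ w∈i)))
                 (countH-blockPath (∈-blockPaths⁻ (suc k) (toℕ j) _ ℓ w∈j))))))))

  ∈-countedPaths⁻ : ∀ {w} → w ∈ countedPaths → IsCountedPath (suc k) ℓ r w
  ∈-countedPaths⁻ w∈ with ∈-map⁻ (replicate ℓ u ++_) w∈
  ... | w′ , w′∈ , refl with ∈-concat⁻′ (tabulate blockPathsOf) w′∈
  ... | ws , w′∈ws , ws∈ with ∈-tabulate⁻ {f = blockPathsOf} ws∈
  ... | i , refl = prefixed⇒counted (m∸n+n≡m (2*i≤r i)) (∈-blockPaths⁻ (suc k) (toℕ i) _ ℓ w′∈ws)

  ∈-countedPaths⁺ : ∀ {w} → IsCountedPath (suc k) ℓ r w → w ∈ countedPaths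
  ∈-countedPaths⁺ counted with counted⇒prefixed ℓ<k counted
  ... | p , s , w′ , refl , refl , v =
    ∈-map⁺ (replicate ℓ u ++_) (∈-concat⁺′ (∈-blockPaths⁺ v′) (∈-tabulate⁺ {f = blockPathsOf} i))
    where
    p<1+⌊r/2⌋ = s≤s (2*≤⇒≤⌊/2⌋ {p} (m≤n+m (2 * p) s))
    i = fromℕ< p<1+⌊r/2⌋
    p≡i = sym (toℕ-fromℕ< p<1+⌊r/2⌋)
    -- Here `r` is `s + 2 * p`, so `s` is `r ∸ 2 * p`, rewritten at the index `i` built from `p`.
    s≡ = trans (sym (m+n∸n≡m s (2 * p))) (cong (λ p′ → s + 2 * p ∸ 2 * p′) p≡i)
    v′ : BlockPath (suc k) (toℕ i) (s + 2 * p ∸ 2 * toℕ i) ℓ w′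
    v′ = subst₂ (λ p s → BlockPath (suc k) p s ℓ w′) p≡i s≡ v

  length-countedPaths : + length countedPaths / 1 ≡ (∑[ p ≤ ⌊ r /2⌋ ] summand (suc k) ℓ r (toℕ p))
  length-countedPaths = begin
    + length countedPaths / 1
      ≡⟨ cong (λ n → + n / 1) (length-map (replicate ℓ u ++_) (concat (tabulate blockPathsOf))) ⟩
    + length (concat (tabulate blockPathsOf)) / 1
      ≡⟨ length-concat-tabulate blockPathsOf ⟩
    ∑[ p ≤ ⌊ r /2⌋ ] (+ length (blockPathsOf p) / 1)
      ≡⟨ sum-cong-≗ {suc ⌊ r /2⌋} (λ i → trans (length-blockPaths≡summand k ℓ (toℕ i) (r ∸ 2 * toℕ i))
           (cong (λ r′ → summand (suc k) ℓ r′ (toℕ i)) (m∸n+n≡m (2*i≤r i)))) ⟩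
    (∑[ p ≤ ⌊ r /2⌋ ] summand (suc k) ℓ r (toℕ p)) ∎

theorem5p2 : (k ℓ r : ℕ) .{{_ : NonZero k}} → ℓ < k →
    ∃[ N ] HasCardinality (IsCountedPath k ℓ r) N ×
    + N / 1 ≡ (∑[ p ≤ ⌊ r /2⌋ ] summand k ℓ r (toℕ p))
theorem5p2 (suc k) ℓ r ℓ<k =
  length (countedPaths k ℓ r ℓ<k) ,
  (countedPaths k ℓ r ℓ<k , countedPaths-unique k ℓ r ℓ<k ,
   (λ w → mk⇔ (∈-countedPaths⁻ k ℓ r ℓ<k) (∈-countedPaths⁺ k ℓ r ℓ<k)) , refl) ,
  length-countedPaths k ℓ r ℓ<k
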